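{- Let $n$ be a positive integer and let $k$ be an integer with $1 \leq k \leq \lceil \frac{n}{2} \rceil$. Then $\gamma(n,[1,n-k],[2,n]) = n-1$.
   Context: $[n]=\{1,\ldots,n\}$. A bicoloring of $[n]$ is a map $B:[n]\to\{ -1,+1\}$; $B(+1)$ and $B(-1)$ denote the sets of points of $[n]$ receiving color $+1$ and $-1$, and $Y_B=(B(1),\ldots,B(n))$. A bicoloring is trivial if it is constant (monochromatic); only non-trivial bicolorings are considered. For $A\subseteq[n]$, $X_A\in\{0,1\}^n$ is the incidence vector of $A$. A non-empty set $A\subseteq [n]$ is an unbiased representative for $B$ if $\langle X_A,Y_B\rangle=0$. A family $\mathcal{A}$ of subsets of $[n]$ is a system of unbiased representatives (SUR) for a set $\mathcal{B}$ of bicolorings if every $B\in\mathcal{B}$ has an unbiased representative in $\mathcal{A}$. $\gamma(n,[k_1,k_2],[r_1,r_2])$ is the maximum, over all sets $\mathcal{B}$ of non-trivial bicolorings of $[n]$ such that $k_1\le |B(+1)|\le k_2$ for every $B\in\mathcal{B}$, of the minimum cardinality of a SUR $\mathcal{A}$ for $\mathcal{B}$ such that $r_1\le |A|\le r_2$ for every $A\in\mathcal{A}$. -}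

module Defs where

import Algebra.Properties.Semiring.Sum
open import Data.Bool.Base using (if_then_else_)
open import Data.Fin.Base using (Fin)
open import Data.Fin.Subset using (Subset; Nonempty; ∣_∣)
open import Data.Integer.Base using (ℤ; 0ℤ; 1ℤ; _*_; _◃_)
open import Data.Integer.Properties using (+-*-semiring)
open import Data.List.Base using (List; length)
open import Data.List.Relation.Unary.All using (All)
open import Data.List.Relation.Unary.Any using (Any)
open import Data.List.Relation.Unary.Unique.Propositional using (Unique)
open import Data.Nat.Base using (ℕ; _≤_)
open import Data.Nat.Properties using (≤-antisym; ≤-trans)
open import Data.Product.Base using (_×_; _,_; ∃-syntax)
open import Data.Sign.Base using (Sign)
open import Data.Sign.Properties using (_≟_)
open import Data.Vec.Base using (Vec; lookup; map)
open import Data.Vec.Functional using (Vector)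
open import Level using (0ℓ)
open import Relation.Binary.PropositionalEquality using (_≡_)
open import Relation.Nullary.Decidable.Core using (does)
open import Relation.Nullary.Negation.Core using (¬_)
open import Relation.Unary using (Pred)

open Algebra.Properties.Semiring.Sum +-*-semiring using (sum)

private
  variable
    n : ℕ

-- Tables of values rather than functions, so that equality of bicolorings is
-- propositional and decidable; this parallels `Subset n = Vec Bool n`.
Bicoloring : ℕ → Set
Bicoloring n = Vec Sign n

Trivial : Bicoloring n → Set
Trivial {n} B = ∃[ s ] ((i : Fin n) → lookup B i ≡ s)

colorClass : Bicoloring n → Sign → Subset n
colorClass B s = map (λ t → does (t ≟ s)) B

X : Subset n → Vector ℤ n
X A i = if lookup A i then 1ℤ else 0ℤ

Y : Bicoloring n → Vector ℤ n
Y B i = lookup B i ◃ 1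

⟨_,_⟩ : Vector ℤ n → Vector ℤ n → ℤ
⟨ u , v ⟩ = sum (λ i → u i * v i)

UnbiasedRepresentative : Subset n → Bicoloring n → Set
UnbiasedRepresentative A B = Nonempty A × ⟨ X A , Y B ⟩ ≡ 0ℤ

IsSUR : List (Subset n) → List (Bicoloring n) → Set
IsSUR 𝒜 ℬ = All (λ B → Any (λ A → UnbiasedRepresentative A B) 𝒜) ℬ

[_⋯_] : ℕ → ℕ → Pred ℕ 0ℓ
[ a ⋯ b ] m = a ≤ m × m ≤ b

Admissible : Pred ℕ 0ℓ → List (Bicoloring n) → Set
Admissible K = All (λ B → ¬ Trivial B × K ∣ colorClass B Sign.+ ∣)

-- `Unique` makes the length of the list 𝒜 the cardinality of the family.
HasSUROfSize : Pred ℕ 0ℓ → List (Bicoloring n) → Pred ℕ 0ℓ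
HasSUROfSize R ℬ m =
  ∃[ 𝒜 ] (Unique 𝒜 × All (λ A → R ∣ A ∣) 𝒜 × IsSUR 𝒜 ℬ × length 𝒜 ≡ m)

IsMinimum : Pred ℕ 0ℓ → Pred ℕ 0ℓ
IsMinimum P m = P m × (∀ j → P j → m ≤ j)

MinSURSize : Pred ℕ 0ℓ → List (Bicoloring n) → Pred ℕ 0ℓ
MinSURSize R ℬ = IsMinimum (HasSUROfSize R ℬ)

-- The graph of γ: the maximum over ℬ of the minimum size of a SUR equals g.
-- The field `bounded` also asserts that the minimum exists for every ℬ, so that
-- a ℬ without any SUR is not silently skipped. Sets ℬ of bicolorings are finite,
-- hence lists; repetitions in ℬ are harmless as its cardinality plays no role.
record γ⟨_,_,_⟩≡_ (n : ℕ) (K R : Pred ℕ 0ℓ) (g : ℕ) : Set where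
  field
    attained : ∃[ ℬ ] (Admissible {n} K ℬ × MinSURSize R ℬ g)
    bounded  : (ℬ : List (Bicoloring n)) → Admissible K ℬ →
               ∃[ m ] (MinSURSize R ℬ m × m ≤ g)

γ-unique : ∀ {K R g h} → γ⟨ n , K , R ⟩≡ g → γ⟨ n , K , R ⟩≡ h → g ≡ h
γ-unique p q = ≤-antisym (below p q) (below q p)
  where
  below : ∀ {K R g h} → γ⟨ n , K , R ⟩≡ g → γ⟨ n , K , R ⟩≡ h → g ≤ h
  below p q with γ⟨_,_,_⟩≡_.attained p
  ... | ℬ , adm , _ , least with γ⟨_,_,_⟩≡_.bounded q ℬ adm
  ... | m , (sur , _) , m≤h = ≤-trans (least m sur) m≤h

{-# OPTIONS --safe #-}

-- Upper bound: a non-constant bicoloring changes sign somewhere along the path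
-- 1, 2, …, n, so the n − 1 edges {i, i + 1} represent every bicoloring.
-- Lower bound: as k ≤ ⌈n/2⌉, every non-trivial B or its negative has at most
-- n − k points of color +1, and both have the same unbiased representatives; so
-- a SUR for all admissible bicolorings represents every non-trivial one. Fix the
-- first color to be +1. Then y ↦ ∏_A ⟨X_A , (1 , y)⟩ is a product of |𝒜| affine
-- forms on {±1}^(n−1) vanishing exactly off the all-ones vector. Its alternating
-- sum over the cube is its value there, hence nonzero, whereas the alternating
-- sum of a product of fewer than n − 1 affine forms is 0.
module Submission where

import Data.Bool.Properties as Bool
open import Data.Fin.Base using (zero; suc)
open import Data.Fin.Subset using (Subset; inside; outside; ∣_∣; ∁; ⊥)
open import Data.Fin.Subset.Properties using (∣p∣≤n; ∣⊥∣≡0; ∣∁p∣≡n∸∣p∣; nonempty?; anySubset?)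
open import Data.Fin.Properties using (all?)
open import Data.Integer.Base using (ℤ; +_; 0ℤ; 1ℤ; -1ℤ; _+_; _-_; _*_; -_; _◃_)
import Data.Integer.Properties as ℤ
open import Data.Integer.Tactic.RingSolver using (solve-∀)
open import Data.List.Base using (List; []; _∷_; _++_; length; map; filter; cartesianProductWith)
open import Data.List.Membership.Propositional using (_∈_)
open import Data.List.Membership.Propositional.Properties using (∈-cartesianProductWith⁺; ∈-filter⁺)
open import Data.List.Properties using (length-++; length-map)
open import Data.List.Relation.Unary.All as All using (All; []; _∷_)
import Data.List.Relation.Unary.All.Properties as All
open import Data.List.Relation.Unary.AllPairs using ([]; _∷_)
open import Data.List.Relation.Unary.Any as Any using (Any; here; there)
import Data.List.Relation.Unary.Any.Properties as Any
open import Data.List.Relation.Unary.Unique.Propositional using (Unique)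
import Data.List.Relation.Unary.Unique.Propositional.Properties as Unique
import Data.List.Relation.Unary.Unique.DecPropositional as DecUnique
open import Data.Nat.Base as ℕ using (ℕ; zero; suc; _≤_; _<_; z≤n; s≤s; _∸_; ⌊_/2⌋; ⌈_/2⌉)
import Data.Nat.Properties as ℕ
open import Data.Product.Base using (_×_; _,_; proj₁; proj₂; ∃-syntax)
open import Data.Sign.Base using (Sign; opposite)
import Data.Sign.Properties as Sign
open import Data.Sum.Base using (_⊎_; inj₁; inj₂)
open import Data.Vec.Base as Vec using ([]; _∷_; lookup; replicate)
import Data.Vec.Properties as Vec
open import Function.Base using (_∘_; _$_)
open import Level using (0ℓ)
open import Relation.Binary.PropositionalEquality
  using (_≡_; _≢_; _≗_; refl; sym; trans; cong; cong₂; subst; module ≡-Reasoning)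
open import Relation.Nullary using (¬_; Dec; yes; no; contradiction)
open import Relation.Nullary.Decidable using (_×-dec_; _⊎-dec_; ¬?; map′)
open import Relation.Unary using (Pred; Decidable)
open import Defs

private
  variable
    n d : ℕ

-- Alternating sums over the cube

-- This is the sum of `f y` weighted by the product of the entries of `y`, that is, `2 ^ d` times
-- the top multilinear coefficient of `f`.
alternatingSum : (Bicoloring d → ℤ) → ℤ
alternatingSum {zero}  f = f []
alternatingSum {suc d} f =
  alternatingSum (λ y → f (Sign.+ ∷ y)) - alternatingSum (λ y → f (Sign.- ∷ y))

alternatingSum-cong : {f g : Bicoloring d → ℤ} → f ≗ g → alternatingSum f ≡ alternatingSum g
alternatingSum-cong {zero}  f≗g = f≗g []
alternatingSum-cong {suc d} f≗g =
  cong₂ _-_ (alternatingSum-cong (f≗g ∘ (Sign.+ ∷_))) (alternatingSum-cong (f≗g ∘ (Sign.- ∷_)))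

alternatingSum-linear : ∀ (c : ℤ) (f g : Bicoloring d → ℤ) →
  alternatingSum (λ y → f y + c * g y) ≡ alternatingSum f + c * alternatingSum g
alternatingSum-linear {zero}  c f g = refl
alternatingSum-linear {suc d} c f g = trans
  (cong₂ _-_ (alternatingSum-linear c (f ∘ (Sign.+ ∷_)) (g ∘ (Sign.+ ∷_)))
             (alternatingSum-linear c (f ∘ (Sign.- ∷_)) (g ∘ (Sign.- ∷_))))
  (regroup c (alternatingSum (f ∘ (Sign.+ ∷_))) (alternatingSum (g ∘ (Sign.+ ∷_)))
             (alternatingSum (f ∘ (Sign.- ∷_))) (alternatingSum (g ∘ (Sign.- ∷_))))
  where
  regroup : ∀ c p q r s → (p + c * q) - (r + c * s) ≡ (p - r) + c * (q - s)
  regroup = solve-∀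

alternatingSum-zero : {f : Bicoloring d → ℤ} → (∀ y → f y ≡ 0ℤ) → alternatingSum f ≡ 0ℤ
alternatingSum-zero {zero}  f≡0 = f≡0 []
alternatingSum-zero {suc d} f≡0 =
  cong₂ _-_ (alternatingSum-zero (f≡0 ∘ (Sign.+ ∷_))) (alternatingSum-zero (f≡0 ∘ (Sign.- ∷_)))

-- The all-plus vector carries weight 1 and lies in the plus half at every stage, so each minus half
-- sums to 0.
alternatingSum-supported : {f : Bicoloring d → ℤ} →
  (∀ y → y ≢ replicate d Sign.+ → f y ≡ 0ℤ) → alternatingSum f ≡ f (replicate d Sign.+)
alternatingSum-supported {zero}  _ = refl
alternatingSum-supported {suc d} f≡0 = trans
  (cong₂ _-_
    (alternatingSum-supported (λ y y≢ → f≡0 (Sign.+ ∷ y) (y≢ ∘ Vec.∷-injectiveʳ)))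
    (alternatingSum-zero (λ y → f≡0 (Sign.- ∷ y) λ ())))
  (ℤ.+-identityʳ _)

-- Products of affine forms

-- (c , A) encodes the affine form y ↦ c + ∑_{i ∈ A} y_i.
AffineForm : ℕ → Set
AffineForm d = ℤ × Subset d

value : AffineForm d → Bicoloring d → ℤ
value (c , A) y = c + ⟨ X A , Y y ⟩

-- Once the first variable is fixed to `s`, its term is absorbed into the constant.
restrict : Sign → AffineForm (suc d) → AffineForm d
restrict s (c , b ∷ A) = c + X (b ∷ A) zero * (s ◃ 1) , A

value-restrict : ∀ s (φ : AffineForm (suc d)) y → value (restrict s φ) y ≡ value φ (s ∷ y)
value-restrict s (c , b ∷ A) y = ℤ.+-assoc c _ _

productOf : List (AffineForm d) → Bicoloring d → ℤ
productOf []       y = 1ℤ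
productOf (φ ∷ φs) y = value φ y * productOf φs y

productOf-restrict : ∀ s (φs : List (AffineForm (suc d))) y →
  productOf (map (restrict s) φs) y ≡ productOf φs (s ∷ y)
productOf-restrict s []       y = refl
productOf-restrict s (φ ∷ φs) y =
  cong₂ _*_ (value-restrict s φ y) (productOf-restrict s φs y)

productOf-++ : ∀ (φs ψs : List (AffineForm d)) y →
  productOf (φs ++ ψs) y ≡ productOf φs y * productOf ψs y
productOf-++ []       ψs y = sym (ℤ.*-identityˡ _)
productOf-++ (φ ∷ φs) ψs y =
  trans (cong (value φ y *_) (productOf-++ φs ψs y)) (sym (ℤ.*-assoc (value φ y) _ _))

productOf≡0 : ∀ {φs : List (AffineForm d)} {y} →
  Any (λ φ → value φ y ≡ 0ℤ) φs → productOf φs y ≡ 0ℤ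
productOf≡0 {φs = φ ∷ φs} {y} (here eq)   = cong (_* productOf φs y) eq
productOf≡0 {φs = φ ∷ φs} {y} (there any) =
  trans (cong (value φ y *_) (productOf≡0 any)) (ℤ.*-zeroʳ (value φ y))

productOf≢0 : ∀ {φs : List (AffineForm d)} {y} →
  All (λ φ → value φ y ≢ 0ℤ) φs → productOf φs y ≢ 0ℤ
productOf≢0 {φs = []}     []         = λ ()
productOf≢0 {φs = φ ∷ φs} {y} (v≢0 ∷ rest) eq with ℤ.i*j≡0⇒i≡0∨j≡0 (value φ y) eq
... | inj₁ v≡0 = v≢0 v≡0
... | inj₂ p≡0 = productOf≢0 rest p≡0

-- Named separately so that the induction on `d` can hand its hypothesis to `swap-restrictions`.
LowDegreeVanishing : ℕ → Set
LowDegreeVanishing d =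
  (φs : List (AffineForm d)) → length φs < d → alternatingSum (productOf φs) ≡ 0ℤ

-- The two restrictions of a form differ by a constant, so replacing one by the
-- other changes the product by a multiple of a product with one factor fewer.
swap-restrictions : LowDegreeVanishing d →
  ∀ (ψs : List (AffineForm d)) (φs : List (AffineForm (suc d))) → length ψs ℕ.+ length φs ≤ d →
  alternatingSum (λ y → productOf ψs y * productOf (map (restrict Sign.+) φs) y) ≡
  alternatingSum (λ y → productOf ψs y * productOf (map (restrict Sign.-) φs) y)
swap-restrictions vanishes ψs [] _ = refl
swap-restrictions {d} vanishes ψs (φ@(c , b ∷ A) ∷ φs) small = begin
  alternatingSum (λ y → Ψ y * (value φ₊ y * Φ₊ y))
    ≡⟨ alternatingSum-cong (λ y → rotate (Ψ y) (value φ₊ y) (Φ₊ y)) ⟩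
  alternatingSum (λ y → (value φ₊ y * Ψ y) * Φ₊ y)
    -- Moving `φ₊` into the accumulator preserves the number of factors; the recursion then swaps
    -- the whole tail.
    ≡⟨ swap-restrictions vanishes (φ₊ ∷ ψs) φs (subst (_≤ d) (ℕ.+-suc _ _) small) ⟩
  alternatingSum (λ y → (value φ₊ y * Ψ y) * Φ₋ y)
    ≡⟨ alternatingSum-cong difference ⟩
  alternatingSum (λ y → Ψ y * (value φ₋ y * Φ₋ y) + (x + x) * productOf (ψs ++ φs₋) y)
    ≡⟨ alternatingSum-linear (x + x) (λ y → Ψ y * (value φ₋ y * Φ₋ y)) (productOf (ψs ++ φs₋)) ⟩
  alternatingSum (λ y → Ψ y * (value φ₋ y * Φ₋ y)) + (x + x) * alternatingSum (productOf (ψs ++ φs₋))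
    -- Without `φ` at most `d - 1` factors remain, so the hypothesis on `d` variables applies.
    ≡⟨ cong (λ z → alternatingSum (λ y → Ψ y * (value φ₋ y * Φ₋ y)) + (x + x) * z)
            (vanishes (ψs ++ φs₋) shorter) ⟩
  alternatingSum (λ y → Ψ y * (value φ₋ y * Φ₋ y)) + (x + x) * 0ℤ
    ≡⟨ drop-zero _ (x + x) ⟩
  alternatingSum (λ y → Ψ y * (value φ₋ y * Φ₋ y)) ∎
  where
  open ≡-Reasoning
  x   = X (b ∷ A) zero
  φ₊  = restrict Sign.+ φ
  φ₋  = restrict Sign.- φ
  φs₋ = map (restrict Sign.-) φs
  Ψ   = productOf ψs
  Φ₊  = productOf (map (restrict Sign.+) φs)
  Φ₋  = productOf φs₋

  rotate : ∀ p q r → p * (q * r) ≡ (q * p) * r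
  rotate = solve-∀

  drop-zero : ∀ p q → p + q * 0ℤ ≡ p
  drop-zero = solve-∀

  -- The two signs contribute `x` and `- x`, so the restrictions of `φ` differ by `x + x`.
  expand : ∀ c x t p q → ((c + x * 1ℤ + t) * p) * q ≡ p * ((c + x * -1ℤ + t) * q) + (x + x) * (p * q)
  expand = solve-∀

  difference : ∀ y → (value φ₊ y * Ψ y) * Φ₋ y ≡
    Ψ y * (value φ₋ y * Φ₋ y) + (x + x) * productOf (ψs ++ φs₋) y
  difference y rewrite productOf-++ ψs φs₋ y = expand c x ⟨ X A , Y y ⟩ (Ψ y) (Φ₋ y)

  shorter : length (ψs ++ φs₋) < d
  shorter = subst (_≤ d)
    (trans (ℕ.+-suc _ _)
      (cong suc (sym (trans (length-++ ψs) (cong (length ψs ℕ.+_) (length-map _ φs))))))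
    small

-- Splitting on the first sign gives a difference of two sums over the smaller cube, and at most `d`
-- forms remain, so `swap-restrictions` makes them equal. No list is shorter than 0, which settles
-- the base case.
low-degree-vanishes : ∀ d → LowDegreeVanishing d
low-degree-vanishes (suc d) φs (s≤s small) =
  ℤ.i≡j⇒i-j≡0 $ begin
  alternatingSum (λ y → productOf φs (Sign.+ ∷ y))
    ≡⟨ alternatingSum-cong (padded Sign.+) ⟨
  alternatingSum (λ y → 1ℤ * productOf (map (restrict Sign.+) φs) y)
    ≡⟨ swap-restrictions (low-degree-vanishes d) [] φs small ⟩
  alternatingSum (λ y → 1ℤ * productOf (map (restrict Sign.-) φs) y)
    ≡⟨ alternatingSum-cong (padded Sign.-) ⟩
  alternatingSum (λ y → productOf φs (Sign.- ∷ y)) ∎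
  where
  open ≡-Reasoning
  -- The factor `1ℤ` is the product over the empty accumulator.
  padded : ∀ s y → 1ℤ * productOf (map (restrict s) φs) y ≡ productOf φs (s ∷ y)
  padded s y = trans (ℤ.*-identityˡ _) (productOf-restrict s φs y)

-- Bicolorings and unbiased representatives

⟨X,Y-replicate⟩≡size : (A : Subset n) → ⟨ X A , Y (replicate n Sign.+) ⟩ ≡ + ∣ A ∣
⟨X,Y-replicate⟩≡size []            = refl
⟨X,Y-replicate⟩≡size (inside ∷ A)  = cong (λ z → 1ℤ + z) (⟨X,Y-replicate⟩≡size A)
⟨X,Y-replicate⟩≡size (outside ∷ A) = trans (ℤ.+-identityˡ _) (⟨X,Y-replicate⟩≡size A)

⟨X,Y-opposite⟩ : (A : Subset n) (B : Bicoloring n) →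
  ⟨ X A , Y (Vec.map opposite B) ⟩ ≡ - ⟨ X A , Y B ⟩
⟨X,Y-opposite⟩ []      []      = refl
⟨X,Y-opposite⟩ (b ∷ A) (s ∷ B) = trans
  (cong₂ _+_ (trans (cong (X (b ∷ A) zero *_) (opposite-◃ s)) (sym (ℤ.neg-distribʳ-* (X (b ∷ A) zero) (s ◃ 1))))
             (⟨X,Y-opposite⟩ A B))
  (sym (ℤ.neg-distrib-+ (X (b ∷ A) zero * (s ◃ 1)) _))
  where
  opposite-◃ : ∀ s → opposite s ◃ 1 ≡ - (s ◃ 1)
  opposite-◃ Sign.+ = refl
  opposite-◃ Sign.- = refl

trivial-∷⇒replicate : ∀ {s} {B : Bicoloring d} → Trivial (s ∷ B) → B ≡ replicate d s
trivial-∷⇒replicate {d} {s} {B} (t , eq) = begin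
  B                                   ≡⟨ Vec.tabulate∘lookup B ⟨
  Vec.tabulate (lookup B)             ≡⟨ Vec.tabulate-cong constant ⟩
  Vec.tabulate (lookup (replicate d s)) ≡⟨ Vec.tabulate∘lookup _ ⟩
  replicate d s                       ∎
  where
  open ≡-Reasoning
  constant : lookup B ≗ lookup (replicate d s)
  constant i = trans (eq (suc i)) (trans (sym (eq zero)) (sym (Vec.lookup-replicate i s)))

trivial-opposite⁻ : (B : Bicoloring n) → Trivial (Vec.map opposite B) → Trivial B
trivial-opposite⁻ B (s , eq) = opposite s , λ i →
  Sign.opposite-injective (trans (sym (Vec.lookup-map i opposite B))
    (trans (eq i) (sym (Sign.opposite-selfInverse refl))))

no-plus⇒minus : (B : Bicoloring n) → ∣ colorClass B Sign.+ ∣ ≡ 0 → ∀ i → lookup B i ≡ Sign.-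
no-plus⇒minus (Sign.- ∷ B) eq zero    = refl
no-plus⇒minus (Sign.- ∷ B) eq (suc i) = no-plus⇒minus B eq i

-- Supplies the lower end of `[ 1 ⋯ n ∸ k ]`, for a bicoloring as well as for its negative.
nontrivial⇒plus : (B : Bicoloring n) → ¬ Trivial B → 1 ≤ ∣ colorClass B Sign.+ ∣
nontrivial⇒plus B ¬triv = ℕ.n≢0⇒n>0 λ eq → ¬triv (Sign.- , no-plus⇒minus B eq)

colorClass-opposite : (B : Bicoloring n) →
  colorClass (Vec.map opposite B) Sign.+ ≡ ∁ (colorClass B Sign.+)
colorClass-opposite []           = refl
colorClass-opposite (Sign.+ ∷ B) = cong (outside ∷_) (colorClass-opposite B)
colorClass-opposite (Sign.- ∷ B) = cong (inside ∷_) (colorClass-opposite B)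

trivial? : Decidable (Trivial {n})
trivial? B = map′ to from (constant? Sign.+ ⊎-dec constant? Sign.-)
  where
  Constant = λ s → ∀ i → lookup B i ≡ s
  constant? : Decidable Constant
  constant? s = all? λ i → lookup B i Sign.≟ s
  to : Constant Sign.+ ⊎ Constant Sign.- → Trivial B
  to (inj₁ p) = Sign.+ , p
  to (inj₂ p) = Sign.- , p
  from : Trivial B → Constant Sign.+ ⊎ Constant Sign.-
  from (Sign.+ , p) = inj₁ p
  from (Sign.- , p) = inj₂ p

Unbiased : Subset n → Bicoloring n → Set
Unbiased A B = ⟨ X A , Y B ⟩ ≡ 0ℤ

unbiased-opposite⁻ : (A : Subset n) (B : Bicoloring n) → Unbiased A (Vec.map opposite B) → Unbiased A B
unbiased-opposite⁻ A B eq = ℤ.neg-injective (trans (sym (⟨X,Y-opposite⟩ A B)) eq)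

-- Lower bound

-- With fewer than `d` forms the alternating sum would be 0, but it equals the product of the sizes
-- `∣ A ∣`, all positive.
representing-nontrivial⇒long : (𝒜 : List (Subset (suc d))) → All (λ A → 1 ≤ ∣ A ∣) 𝒜 →
  (∀ B → ¬ Trivial B → Any (λ A → Unbiased A B) 𝒜) → d ≤ length 𝒜
representing-nontrivial⇒long {d} 𝒜 nonempty represents = ℕ.≮⇒≥ λ short →
  productOf≢0 {y = replicate d Sign.+} (All.map⁺ (All.map (λ {A} → nonzero A) nonempty))
    (trans (sym (alternatingSum-supported off-ones))
           (low-degree-vanishes d φs (subst (_< d) (sym (length-map _ 𝒜)) short)))
  where
  form : Subset (suc d) → AffineForm d
  form A = restrict Sign.+ (0ℤ , A)

  φs = map form 𝒜

  value-form : ∀ A y → value (form A) y ≡ ⟨ X A , Y (Sign.+ ∷ y) ⟩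
  value-form A y = trans (value-restrict Sign.+ (0ℤ , A) y) (ℤ.+-identityˡ _)

  nonzero : ∀ A → 1 ≤ ∣ A ∣ → value (form A) (replicate d Sign.+) ≢ 0ℤ
  nonzero A 1≤A eq = ℕ.n>0⇒n≢0 1≤A (ℤ.+-injective
    (trans (sym (⟨X,Y-replicate⟩≡size A)) (trans (sym (value-form A (replicate d Sign.+))) eq)))

  -- Here `Sign.+ ∷ y` is not constant, so some member of `𝒜` makes its factor vanish.
  off-ones : ∀ y → y ≢ replicate d Sign.+ → productOf φs y ≡ 0ℤ
  off-ones y y≢ = productOf≡0 (Any.map⁺
    (Any.map (λ {A} → trans (value-form A y)) (represents (Sign.+ ∷ y) (y≢ ∘ trivial-∷⇒replicate))))

-- Enumeration of the admissible bicolorings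

allBicolorings : ∀ n → List (Bicoloring n)
allBicolorings zero    = [] ∷ []
allBicolorings (suc n) = cartesianProductWith _∷_ (Sign.+ ∷ Sign.- ∷ []) (allBicolorings n)

∈-allBicolorings : (B : Bicoloring n) → B ∈ allBicolorings n
∈-allBicolorings []      = here refl
∈-allBicolorings (s ∷ B) = ∈-cartesianProductWith⁺ _∷_ (sign∈ s) (∈-allBicolorings B)
  where
  sign∈ : ∀ s → s ∈ Sign.+ ∷ Sign.- ∷ []
  sign∈ Sign.+ = here refl
  sign∈ Sign.- = there (here refl)

interval? : ∀ a b → Decidable [ a ⋯ b ]
interval? a b m = a ℕ.≤? m ×-dec m ℕ.≤? b

admissible? : {K : Pred ℕ 0ℓ} → Decidable K →
  Decidable (λ (B : Bicoloring n) → ¬ Trivial B × K ∣ colorClass B Sign.+ ∣)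
admissible? K? B = ¬? (trivial? B) ×-dec K? ∣ colorClass B Sign.+ ∣

admissibleBicolorings : ∀ n {K : Pred ℕ 0ℓ} → Decidable K → List (Bicoloring n)
admissibleBicolorings n K? = filter (admissible? K?) (allBicolorings n)

≤n∸k⊎n∸≤n∸k : ∀ {n k} b → k ≤ ⌈ n /2⌉ → b ≤ n ∸ k ⊎ n ∸ b ≤ n ∸ k
≤n∸k⊎n∸≤n∸k {n} {k} b k≤ with k ℕ.≤? b
... | yes k≤b = inj₂ (ℕ.∸-monoʳ-≤ n k≤b)
... | no  k≰b = inj₁ $ begin
  -- From `b < k` follows `suc b ≤ ⌈ n /2⌉ ≤ suc ⌊ n /2⌋`, as `⌈ n /2⌉` is the floor of half of
  -- `suc n`.
  b             ≤⟨ ℕ.s≤s⁻¹ (ℕ.≤-trans (ℕ.≰⇒> k≰b) (ℕ.≤-trans k≤ (ℕ.⌊n/2⌋-mono (ℕ.n≤1+n (suc n))))) ⟩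
  ⌊ n /2⌋       ≡⟨ ℕ.m+n∸n≡m ⌊ n /2⌋ ⌈ n /2⌉ ⟨
  ⌊ n /2⌋ ℕ.+ ⌈ n /2⌉ ∸ ⌈ n /2⌉ ≡⟨ cong (_∸ ⌈ n /2⌉) (ℕ.⌊n/2⌋+⌈n/2⌉≡n n) ⟩
  n ∸ ⌈ n /2⌉   ≤⟨ ℕ.∸-monoʳ-≤ n k≤ ⟩
  n ∸ k         ∎
  where open ℕ.≤-Reasoning

sur⇒represents-nontrivial : ∀ {n k} {𝒜 : List (Subset n)} → k ≤ ⌈ n /2⌉ →
  IsSUR 𝒜 (admissibleBicolorings n (interval? 1 (n ∸ k))) →
  ∀ B → ¬ Trivial B → Any (λ A → Unbiased A B) 𝒜
sur⇒represents-nontrivial {n} {k} {𝒜} k≤ sur B ¬triv = orient (≤n∸k⊎n∸≤n∸k p k≤)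
  where
  p = ∣ colorClass B Sign.+ ∣

  represented : ∀ B → ¬ Trivial B → ∣ colorClass B Sign.+ ∣ ≤ n ∸ k → Any (λ A → Unbiased A B) 𝒜
  represented B ¬triv small = Any.map proj₂ (All.lookup sur
    (∈-filter⁺ (admissible? (interval? 1 (n ∸ k))) (∈-allBicolorings B)
      (¬triv , nontrivial⇒plus B ¬triv , small)))

  opposite-size : ∣ colorClass (Vec.map opposite B) Sign.+ ∣ ≡ n ∸ p
  opposite-size = trans (cong ∣_∣ (colorClass-opposite B)) (∣∁p∣≡n∸∣p∣ (colorClass B Sign.+))

  orient : p ≤ n ∸ k ⊎ n ∸ p ≤ n ∸ k → Any (λ A → Unbiased A B) 𝒜
  orient (inj₁ small) = represented B ¬triv small
  orient (inj₂ small) = Any.map (λ {A} → unbiased-opposite⁻ A B)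
    (represented (Vec.map opposite B) (¬triv ∘ trivial-opposite⁻ B) (subst (_≤ n ∸ k) (sym opposite-size) small))

-- Upper bound

pathEdges : ∀ n → List (Subset n)
pathEdges zero          = []
pathEdges (suc zero)    = []
pathEdges (suc (suc n)) = (inside ∷ inside ∷ ⊥) ∷ map (outside ∷_) (pathEdges (suc n))

length-pathEdges : ∀ n → length (pathEdges n) ≡ n ∸ 1
length-pathEdges zero          = refl
length-pathEdges (suc zero)    = refl
length-pathEdges (suc (suc n)) = cong suc (trans (length-map _ (pathEdges (suc n))) (length-pathEdges (suc n)))

pathEdges-unique : ∀ n → Unique (pathEdges n)
pathEdges-unique zero          = []
pathEdges-unique (suc zero)    = []
pathEdges-unique (suc (suc n)) =
  -- The first edge contains the point `zero`; the shifted edges avoid it.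
  All.map⁺ (All.universal (λ _ ()) _) ∷ Unique.map⁺ Vec.∷-injectiveʳ (pathEdges-unique (suc n))

pathEdges-size : ∀ n → All (λ A → ∣ A ∣ ≡ 2) (pathEdges n)
pathEdges-size zero          = []
pathEdges-size (suc zero)    = []
pathEdges-size (suc (suc n)) = cong (2 ℕ.+_) (∣⊥∣≡0 n) ∷ All.map⁺ (pathEdges-size (suc n))

unbiased-⊥ : (B : Bicoloring n) → Unbiased ⊥ B
unbiased-⊥ []      = refl
unbiased-⊥ (s ∷ B) = trans (ℤ.+-identityˡ _) (unbiased-⊥ B)

-- Its contrapositive keeps the bicoloring non-trivial when a repeated first color is dropped.
trivial-∷ : ∀ {s} {B : Bicoloring n} → Trivial (s ∷ B) → Trivial (s ∷ s ∷ B)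
trivial-∷ (t , eq) = t , λ { zero → eq zero ; (suc i) → eq i }

representative-outside : (s : Sign) (B : Bicoloring n) {A : Subset n} →
  UnbiasedRepresentative A B → UnbiasedRepresentative (outside ∷ A) (s ∷ B)
representative-outside s _ ((i , i∈A) , eq) = (suc i , Vec.there i∈A) , trans (ℤ.+-identityˡ _) eq

pathEdges-represent : (B : Bicoloring n) → ¬ Trivial B →
  Any (λ A → UnbiasedRepresentative A B) (pathEdges n)
pathEdges-represent []       ¬triv = contradiction (Sign.+ , λ ()) ¬triv
pathEdges-represent (s ∷ []) ¬triv = contradiction (s , λ { zero → refl }) ¬triv
pathEdges-represent (Sign.+ ∷ Sign.- ∷ B) _ =
  here ((zero , Vec.here) , cong (λ z → 1ℤ + (-1ℤ + z)) (unbiased-⊥ B))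
pathEdges-represent (Sign.- ∷ Sign.+ ∷ B) _ =
  here ((zero , Vec.here) , cong (λ z → -1ℤ + (1ℤ + z)) (unbiased-⊥ B))
pathEdges-represent (Sign.+ ∷ B@(Sign.+ ∷ _)) ¬triv =
  there (Any.map⁺ (Any.map (representative-outside Sign.+ B) (pathEdges-represent B (¬triv ∘ trivial-∷))))
pathEdges-represent (Sign.- ∷ B@(Sign.- ∷ _)) ¬triv =
  there (Any.map⁺ (Any.map (representative-outside Sign.- B) (pathEdges-represent B (¬triv ∘ trivial-∷))))

pathEdges-sur : ∀ K {ℬ : List (Bicoloring n)} → Admissible K ℬ → HasSUROfSize [ 2 ⋯ n ] ℬ (n ∸ 1)
pathEdges-sur {n} _ admissible =
  pathEdges n , pathEdges-unique n ,
  All.map (λ {A} size → ℕ.≤-reflexive (sym size) , ∣p∣≤n A) (pathEdges-size n) ,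
  All.map (λ {B} (¬triv , _) → pathEdges-represent B ¬triv) admissible ,
  length-pathEdges n

-- Existence of the minimum

-- Fixing the length makes the search finite: each head ranges over the finitely many subsets, and
-- the tail is sought with `P ∘ (A ∷_)`.
familyOfLength? : ∀ m {P : Pred (List (Subset n)) 0ℓ} → Decidable P →
  Dec (∃[ 𝒜 ] (P 𝒜 × length 𝒜 ≡ m))
familyOfLength? zero P? =
  map′ (λ p → [] , p , refl) (λ { ([] , p , _) → p }) (P? [])
familyOfLength? (suc m) P? =
  map′ (λ (A , 𝒜 , p , len) → A ∷ 𝒜 , p , cong suc len)
       (λ { (A ∷ 𝒜 , p , len) → A , 𝒜 , p , ℕ.suc-injective len })
       (anySubset? λ A → familyOfLength? m (P? ∘ (A ∷_)))

unbiasedRepresentative? : ∀ (B : Bicoloring n) → Decidable (λ A → UnbiasedRepresentative A B)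
unbiasedRepresentative? B A = nonempty? A ×-dec ⟨ X A , Y B ⟩ ℤ.≟ 0ℤ

hasSUROfSize? : ∀ {R} → Decidable R → (ℬ : List (Bicoloring n)) → Decidable (HasSUROfSize R ℬ)
hasSUROfSize? R? ℬ m =
  map′ (λ (𝒜 , (u , r , s) , len) → 𝒜 , u , r , s , len)
       (λ (𝒜 , u , r , s , len) → 𝒜 , (u , r , s) , len)
       (familyOfLength? m λ 𝒜 →
         DecUnique.unique? (Vec.≡-dec Bool._≟_) 𝒜 ×-dec
         All.all? (R? ∘ ∣_∣) 𝒜 ×-dec
         All.all? (λ B → Any.any? (unbiasedRepresentative? B) 𝒜) ℬ)

-- Least-number principle: if 0 fails, the search continues with `P ∘ suc`, and the witness `g`
-- bounds its depth.
minimum-exists : {P : Pred ℕ 0ℓ} → Decidable P → ∀ g → P g → ∃[ m ] (IsMinimum P m × m ≤ g)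
minimum-exists P? g pg with P? 0
... | yes p0 = 0 , (p0 , λ _ _ → z≤n) , z≤n
minimum-exists     P? zero    pg | no ¬p0 = contradiction pg ¬p0
minimum-exists {P} P? (suc g) pg | no ¬p0 with minimum-exists (P? ∘ suc) g pg
... | m , (pm , least) , m≤g = suc m , (pm , least′) , s≤s m≤g
  where
  least′ : ∀ j → P j → suc m ≤ j
  least′ zero    p0 = contradiction p0 ¬p0
  least′ (suc j) pj = s≤s (least j pj)

theorem1 : (n k : ℕ) → 1 ≤ n → 1 ≤ k → k ≤ ⌈ n /2⌉ →
    γ⟨ n , [ 1 ⋯ n ∸ k ] , [ 2 ⋯ n ] ⟩≡ (n ∸ 1)
theorem1 n@(suc d) k _ _ k≤ = record
  -- The extremal family consists of all admissible bicolorings.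
  { attained = admissibleBicolorings n K? , admissible , pathEdges-sur [ 1 ⋯ n ∸ k ] admissible , smallest
  -- The path edges form a SUR of size `d` for any admissible family, so the minimum exists and is
  -- at most `d`.
  ; bounded  = λ ℬ adm →
      minimum-exists (hasSUROfSize? (interval? 2 n) ℬ) d (pathEdges-sur [ 1 ⋯ n ∸ k ] adm)
  }
  where
  K? = interval? 1 (n ∸ k)

  admissible : Admissible [ 1 ⋯ n ∸ k ] (admissibleBicolorings n K?)
  admissible = All.all-filter (admissible? K?) (allBicolorings n)

  smallest : ∀ j → HasSUROfSize [ 2 ⋯ n ] (admissibleBicolorings n K?) j → d ≤ j
  smallest j (𝒜 , _ , sizes , sur , refl) = representing-nontrivial⇒long 𝒜
    (All.map (ℕ.<⇒≤ ∘ proj₁) sizes) (sur⇒represents-nontrivial {k = k} k≤ sur)
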